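{- Let $N=(G=(V,E),\sigma,u,s)$ be a skew-symmetric network with $m=|E|$, and let $f$ be an IS-flow in $N$. Then $f$ has a symmetric decomposition consisting of at most $m$ elementary flows.
   Context: A skew-symmetric graph is a finite directed graph $G=(V,E)$ (parallel arcs allowed) with a map $\sigma$ of $V\cup E$ onto itself such that $\sigma(x)\ne x$, $\sigma(\sigma(x))=x$ for all $x$, $\sigma(V)=V$, and for each arc $a$ from $v$ to $w$, $\sigma(a)$ is an arc from $\sigma(w)$ to $\sigma(v)$; write $x'=\sigma(x)$. The map $\sigma$ extends to paths: $\sigma(P)$ consists of the mates of the elements of $P$ in reverse order. A function $h$ on $E$ is symmetric if $h(a)=h(\sigma(a))$ for all $a$. A skew-symmetric network is $N=(G,\sigma,u,s)$ with $u:E\to\mathbb Z_{\ge0}$ symmetric and a source $s\in V$; $s'=\sigma(s)$ is the sink. A flow is $f:E\to\mathbb R_{\ge 0}$ with $f(a)\le u(a)$ for all $a$ and $\mathrm{div}_f(x):=\sum_{a\text{ leaving }x}f(a)-\sum_{a\text{ entering }x}f(a)=0$ for all $x\in V\setminus\{s,s'\}$; its value is $|f|=\mathrm{div}_f(s)$. An IS-flow is an integer-valued symmetric flow. For a path or cycle $P$, $\chi^P\in\mathbb R^E$ is the incidence vector of its arc set. An elementary flow is an IS-flow in $N$ of the form $g=\delta\chi^P+\delta\chi^{P'}$, where $P$ is a simple cycle, or a simple path from $s$ to $s'$, or a simple path from $s'$ to $s$, $P'=\sigma(P)$, and $\delta$ is a positive integer. A symmetric decomposition of $f$ is a set $D$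 of elementary flows with $f=\sum_{g\in D}g$. -}

module Defs where

import Algebra.Properties.CommutativeMonoid.Sum as Sum
open import Data.Bool using (if_then_else_)
open import Data.Fin using (Fin; _≟_)
open import Data.Integer using (ℤ; 0ℤ; _⊖_)
open import Data.List using (List; []; _∷_; map; reverse)
import Data.List.Membership.DecPropositional as DecMembership
open import Data.List.Relation.Unary.All using (All)
open import Data.List.Relation.Unary.Unique.Propositional using (Unique)
import Data.List.Relation.Unary.Unique.Setoid as SetoidUnique
open import Data.Nat using (ℕ; _+_; _*_; _≤_; _>_)
import Data.Nat.ListAction as List
open import Data.Nat.Properties using (+-0-commutativeMonoid)
open import Data.Product using (_×_; ∃-syntax)
open import Data.Sum using (_⊎_)
open import Relation.Binary.PropositionalEquality using (_≡_; _≢_; _→-setoid_)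
open import Relation.Nullary using (does)

open Sum +-0-commutativeMonoid using (sum)

-- σ preserves V, hence (being a bijection of V ∪ E) also E; it is given by its
-- two restrictions σV and σE.
record SkewSymmetricGraph : Set where
  field
    |V| |E| : ℕ

  V : Set
  V = Fin |V|

  E : Set
  E = Fin |E|

  field
    tail head     : E → V
    σV            : V → V
    σE            : E → E
    σV-fixfree    : ∀ v → σV v ≢ v
    σE-fixfree    : ∀ a → σE a ≢ a
    σV-involutive : ∀ v → σV (σV v) ≡ v
    σE-involutive : ∀ a → σE (σE a) ≡ a
    tail-σE       : ∀ a → tail (σE a) ≡ σV (head a)
    head-σE       : ∀ a → head (σE a) ≡ σV (tail a)

  Symmetric : (E → ℕ) → Set
  Symmetric h = ∀ a → h a ≡ h (σE a)

  -- Walks are recorded by their list of arcs: IsWalk x P y says that P leads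
  -- from x to y.
  data IsWalk : V → List E → V → Set where
    []  : ∀ {x} → IsWalk x [] x
    _∷_ : ∀ {x y a P} → tail a ≡ x → IsWalk (head a) P y → IsWalk x (a ∷ P) y

  -- x ∷ map head P is the sequence of vertices visited by a walk P from x.
  IsSimplePath : V → List E → V → Set
  IsSimplePath x P y = IsWalk x P y × Unique (x ∷ map head P)

  -- For a closed walk from x, map head P lists x once, as its last entry.
  IsSimpleCycle : List E → Set
  IsSimpleCycle P = P ≢ [] × (∃[ x ] IsWalk x P x) × Unique (map head P)

  σP : List E → List E
  σP P = reverse (map σE P)

  open DecMembership (_≟_ {|E|}) using (_∈?_)

  χ : List E → E → ℕ
  χ P a = if does (a ∈? P) then 1 else 0

  outflow inflow : (E → ℕ) → V → ℕ
  outflow f x = sum (λ a → if does (tail a ≟ x) then f a else 0)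
  inflow  f x = sum (λ a → if does (head a ≟ x) then f a else 0)

  -- _⊖_ is the integer difference of two naturals.
  div : (E → ℕ) → V → ℤ
  div f x = outflow f x ⊖ inflow f x

record SkewSymmetricNetwork : Set where
  field
    graph : SkewSymmetricGraph

  open SkewSymmetricGraph graph public

  field
    u           : E → ℕ
    u-symmetric : Symmetric u
    s           : V

  s′ : V
  s′ = σV s

  -- Flows take nonnegative values, so integer-valued ones are exactly those
  -- with values in ℕ.
  record IsISFlow (f : E → ℕ) : Set where
    field
      capacity     : ∀ a → f a ≤ u a
      conservation : ∀ x → x ≢ s → x ≢ s′ → div f x ≡ 0ℤ
      symmetric    : Symmetric f

  record IsElementaryFlow (g : E → ℕ) : Set where
    field
      isISFlow : IsISFlow g
      P        : List E
      shape    : IsSimpleCycle P ⊎ IsSimplePath s P s′ ⊎ IsSimplePath s′ P s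
      δ        : ℕ
      δ>0      : δ > 0
      formula  : ∀ a → g a ≡ δ * χ P a + δ * χ (σP P) a

  -- A finite set of flows is a list without repetitions, where flows are
  -- compared pointwise.
  record IsSymmetricDecomposition (D : List (E → ℕ)) (f : E → ℕ) : Set where
    field
      elementary : All IsElementaryFlow D
      distinct   : SetoidUnique.Unique (E →-setoid ℕ) D
      sums-to    : ∀ a → f a ≡ List.sum (map (λ g → g a) D)

{-# OPTIONS --safe #-}

-- Write c(P) = χ^P + χ^σ(P) (χ² P below), and call P admissible for f if
-- c(P) ≤ f.  An admissible simple path P is extended backwards: at its first
-- vertex y the outflow of c(P) exceeds its inflow, which fails for f, so some
-- arc a into y has c(P)(a) < f(a).  By symmetry the same holds at σ(a) ≠ a, so
-- a ∷ P is again admissible.  The extension ends at the opposite terminal, or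
-- when a vertex repeats, which closes a simple cycle.
--
-- Subtract δ c(P) with δ maximal.  Maximality leaves less than c(P)(a) ≤ 2 on
-- some arc a, hence also on σ(a), so Σ min(f, 2), initially at most 2m, drops
-- by at least 2 in each step.  Moreover less than δ c(P)(a) is left on a, so
-- the same elementary flow never occurs again.

module Submission where

open import Defs
import Algebra.Properties.CommutativeMonoid.Sum as Sum
open import Algebra.Properties.CommutativeSemigroup using (interchange)
open import Data.Bool using (true; false; if_then_else_)
open import Data.Bool.Properties using (if-eta)
open import Data.Empty using (⊥)
open import Data.Fin using (Fin; zero; suc; _≟_)
open import Data.Fin.Permutation using (permutation)
open import Data.Fin.Properties using (any?; all?; ¬∀⟶∃¬)
open import Data.Integer using (0ℤ; _⊖_)
import Data.Integer.Properties as ℤ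
open import Data.List using (List; []; _∷_; length; map)
open import Data.List.Membership.Propositional using (_∈_; _∉_)
open import Data.List.Membership.Propositional.Properties using (∈-map⁺; ∈-map⁻)
import Data.List.Membership.DecPropositional as DecMembership
open import Data.List.Relation.Binary.Subset.Propositional using (_⊆_)
import Data.List.Relation.Binary.Subset.Propositional.Properties as Subset
open import Data.List.Relation.Unary.All as All using (All; []; _∷_)
open import Data.List.Relation.Unary.All.Properties using (anti-mono; ¬Any⇒All¬)
open import Data.List.Relation.Unary.AllPairs using ([]; _∷_)
open import Data.List.Relation.Unary.Any using (here; there)
open import Data.List.Relation.Unary.Any.Properties using (reverse⁺; reverse⁻)
open import Data.List.Relation.Unary.Unique.Propositional using (Unique)
open import Data.List.Relation.Unary.Unique.Propositional.Properties
  using (map⁻; Unique[x∷xs]⇒x∉xs)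
import Data.Nat.ListAction as List
open import Data.Nat using (ℕ; zero; suc; _+_; _*_; _∸_; _⊓_; _≤_; _<_;
  z≤n; s≤s; z<s; _≤?_; _<?_; >-nonZero)
open import Data.Nat.Properties hiding (_≟_)
open import Data.Product using (_×_; _,_; ∃-syntax)
open import Data.Sum using (_⊎_; inj₁; inj₂)
open import Function using (_∘_; mk⇔)
open import Relation.Binary.Definitions using (tri<; tri≈; tri>)
open import Relation.Binary.PropositionalEquality
open import Relation.Nullary using (¬_; Dec; does; yes; no; contradiction)
open import Relation.Nullary.Decidable using (dec-true; dec-false; does-⇔; _×-dec_)
open import Relation.Unary using (Decidable)

open Sum +-0-commutativeMonoid
  using (sum; sum-cong-≗; sum-replicate-zero; sum-permute; ∑-distrib-+)

-- Finite sums of naturals and maximal multiples.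

+-interchange : ∀ a b c d → (a + b) + (c + d) ≡ (a + c) + (b + d)
+-interchange = interchange +-commutativeSemigroup

sum-mono : ∀ {n} {f g : Fin n → ℕ} → (∀ i → f i ≤ g i) → sum f ≤ sum g
sum-mono {zero}  f≤g = z≤n
sum-mono {suc n} f≤g = +-mono-≤ (f≤g zero) (sum-mono (f≤g ∘ suc))

sum-zero : ∀ {n} {f : Fin n → ℕ} → (∀ i → f i ≡ 0) → sum f ≡ 0
sum-zero {n} f≡0 = trans (sum-cong-≗ f≡0) (sum-replicate-zero n)

sum≤n*k : ∀ {n} k {f : Fin n → ℕ} → (∀ i → f i ≤ k) → sum f ≤ n * k
sum≤n*k {zero}  k f≤k = z≤n
sum≤n*k {suc n} k f≤k = +-mono-≤ (f≤k zero) (sum≤n*k k (f≤k ∘ suc))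

sum-single : ∀ {n} (f : Fin n → ℕ) i → sum (λ j → if does (j ≟ i) then f j else 0) ≡ f i
sum-single {suc n} f zero = trans (cong (f zero +_) (sum-replicate-zero n)) (+-identityʳ _)
sum-single {suc n} f (suc i) = sum-single (f ∘ suc) i

⊖≡0⇒≡ : ∀ m n → m ⊖ n ≡ 0ℤ → m ≡ n
⊖≡0⇒≡ m n eq = ℤ.+-injective (ℤ.i-j≡0⇒i≡j _ _ (trans (ℤ.m-n≡m⊖n m n) eq))

≡⇒⊖≡0 : ∀ {m n} → m ≡ n → m ⊖ n ≡ 0ℤ
≡⇒⊖≡0 {m} refl = ℤ.n⊖n≡0 m

𝟙 : ∀ {n} → Fin n → Fin n → ℕ
𝟙 x y = if does (x ≟ y) then 1 else 0

𝟙-refl : ∀ {n} (x : Fin n) → 𝟙 x x ≡ 1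
𝟙-refl x = cong (if_then 1 else 0) (dec-true (x ≟ x) refl)

𝟙-≢ : ∀ {n} {x y : Fin n} → x ≢ y → 𝟙 x y ≡ 0
𝟙-≢ {x = x} {y} x≢y = cong (if_then 1 else 0) (dec-false (x ≟ y) x≢y)

-- Raise `δ` while the next multiple still fits; an index where it fails is the witness of
-- maximality. `k` bounds the remaining raises: since `c i` is positive, a multiplier that has
-- reached `f i` cannot be raised, so at `k = 0` the index `i` itself is the witness.
maximal-multiple : ∀ {n} (c f : Fin n → ℕ) i → 1 ≤ c i → ∀ k δ →
  f i ≤ k + δ → (∀ j → δ * c j ≤ f j) →
  ∃[ ε ] (δ ≤ ε × (∀ j → ε * c j ≤ f j) × ∃[ j ] f j < suc ε * c j)
maximal-multiple c f i 1≤c zero δ fi≤ δc≤f =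
  δ , ≤-refl , δc≤f , i , ≤-trans (s≤s fi≤) (m≤m*n (suc δ) (c i) {{>-nonZero 1≤c}})
maximal-multiple c f i 1≤c (suc k) δ fi≤ δc≤f with all? (λ j → suc δ * c j ≤? f j)
... | no ¬≤ = let j , ≰ = ¬∀⟶∃¬ _ _ (λ j → suc δ * c j ≤? f j) ¬≤ in
  δ , ≤-refl , δc≤f , j , ≰⇒> ≰
... | yes ≤f =
  let ε , δ<ε , rest = maximal-multiple c f i 1≤c k (suc δ) (subst (f i ≤_) (sym (+-suc k δ)) fi≤) ≤f
  in ε , <⇒≤ δ<ε , rest

-- Flow through a vertex and its behaviour under the mate map.

module Graph (G : SkewSymmetricGraph) where
  open SkewSymmetricGraph G

  open DecMembership (_≟_ {|E|}) using () renaming (_∈?_ to _∈E?_)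
  open DecMembership (_≟_ {|V|}) using () renaming (_∈?_ to _∈V?_)

  -- outflow f is flow tail f and inflow f is flow head f, definitionally.
  flow : (E → V) → (E → ℕ) → V → ℕ
  flow φ f x = sum (λ a → if does (φ a ≟ x) then f a else 0)

  flow-mono : ∀ φ {f g x} → (∀ a → φ a ≡ x → f a ≤ g a) → flow φ f x ≤ flow φ g x
  flow-mono φ {f} {g} {x} f≤g = sum-mono pointwise
    where
    pointwise : ∀ a → (if does (φ a ≟ x) then f a else 0) ≤ (if does (φ a ≟ x) then g a else 0)
    pointwise a with φ a ≟ x
    ... | yes eq = f≤g a eq
    ... | no  _  = z≤n

  flow-cong : ∀ φ {f g} x → (∀ a → f a ≡ g a) → flow φ f x ≡ flow φ g x
  flow-cong φ x f≗g = sum-cong-≗ λ a → cong (if does (φ a ≟ x) then_else 0) (f≗g a)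

  flow-0 : ∀ φ x → flow φ (λ _ → 0) x ≡ 0
  flow-0 φ x = sum-zero λ a → if-eta (does (φ a ≟ x))

  flow-+ : ∀ φ f g x → flow φ (λ a → f a + g a) x ≡ flow φ f x + flow φ g x
  flow-+ φ f g x = trans (sum-cong-≗ λ a → split (does (φ a ≟ x)) a)
    (∑-distrib-+ (λ a → if does (φ a ≟ x) then f a else 0)
                 (λ a → if does (φ a ≟ x) then g a else 0))
    where
    split : ∀ b a → (if b then f a + g a else 0) ≡ (if b then f a else 0) + (if b then g a else 0)
    split true  a = refl
    split false a = refl

  flow-* : ∀ φ k f x → flow φ (λ a → k * f a) x ≡ k * flow φ f x
  flow-* φ zero    f x = flow-0 φ x
  flow-* φ (suc k) f x = trans (flow-+ φ f (λ a → k * f a) x) (cong (flow φ f x +_) (flow-* φ k f x))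

  σV-adjoint : ∀ {x y} → σV x ≡ y → x ≡ σV y
  σV-adjoint {x} eq = trans (sym (σV-involutive x)) (cong σV eq)

  -- Reindexing the sum by the involution `σE` turns the test `φ (σE a) ≡ x` into `ψ a ≡ σV x`.
  -- Taking tail and head for `φ` and `ψ`, in either order, shows that mates exchange inflow and
  -- outflow.
  flow-σ : ∀ {φ ψ} → (∀ a → φ (σE a) ≡ σV (ψ a)) → ∀ f x →
           flow φ (f ∘ σE) x ≡ flow ψ f (σV x)
  flow-σ {φ} {ψ} φσ f x =
    trans (sum-permute _ (permutation σE σE σE-involutive σE-involutive))
          (sum-cong-≗ λ a → cong₂ (if_then_else 0)
            (does-⇔ (mk⇔ (λ eq → σV-adjoint (trans (sym (φσ a)) eq))
                         (λ eq → trans (φσ a) (sym (σV-adjoint (sym eq)))))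
                    (φ (σE a) ≟ x) (ψ a ≟ σV x))
            (cong f (σE-involutive a)))

  outflow-σ : ∀ {f} → Symmetric f → ∀ x → outflow f (σV x) ≡ inflow f x
  outflow-σ {f} f-sym x = sym (trans (flow-cong head x f-sym) (flow-σ {head} {tail} head-σE f x))

  inflow-σ : ∀ {f} → Symmetric f → ∀ x → inflow f (σV x) ≡ outflow f x
  inflow-σ {f} f-sym x = sym (trans (flow-cong tail x f-sym) (flow-σ {tail} {head} tail-σE f x))

  -- Incidence vectors of a walk and its mate.

  χ≤1 : ∀ P a → χ P a ≤ 1
  χ≤1 P a with does (a ∈E? P)
  ... | true  = ≤-refl
  ... | false = z≤n

  χ-∈ : ∀ {P a} → a ∈ P → χ P a ≡ 1
  χ-∈ {P} {a} a∈P = cong (if_then 1 else 0) (dec-true (a ∈E? P) a∈P)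

  χ-∉ : ∀ {P a} → a ∉ P → χ P a ≡ 0
  χ-∉ {P} {a} a∉P = cong (if_then 1 else 0) (dec-false (a ∈E? P) a∉P)

  χ-mono : ∀ {P Q} → P ⊆ Q → ∀ a → χ P a ≤ χ Q a
  χ-mono {P} {Q} P⊆Q a with a ∈E? P
  ... | yes a∈P = ≤-reflexive (sym (χ-∈ (P⊆Q a∈P)))
  ... | no  _   = z≤n

  χ-∷ : ∀ {a P} → a ∉ P → ∀ b → χ (a ∷ P) b ≡ 𝟙 b a + χ P b
  χ-∷ {a} {P} a∉P b with b ≟ a
  ... | yes refl = cong suc (sym (χ-∉ a∉P))
  ... | no  _    = refl

  χ-σP : ∀ P a → χ (σP P) a ≡ χ P (σE a)
  χ-σP P a = cong (if_then 1 else 0) (does-⇔ (mk⇔ to from) (a ∈E? σP P) (σE a ∈E? P))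
    where
    to : a ∈ σP P → σE a ∈ P
    to a∈ with b , b∈P , refl ← ∈-map⁻ σE (reverse⁻ a∈) = subst (_∈ P) (sym (σE-involutive b)) b∈P
    from : σE a ∈ P → a ∈ σP P
    from σa∈ = reverse⁺ (subst (_∈ map σE P) (σE-involutive a) (∈-map⁺ σE σa∈))

  flow-𝟙 : ∀ φ a x → flow φ (λ b → 𝟙 b a) x ≡ 𝟙 (φ a) x
  -- Exchanging the two tests leaves a sum supported at the single arc `a`.
  flow-𝟙 φ a x = trans (sum-cong-≗ λ b → swap (does (φ b ≟ x)) (does (b ≟ a)))
                       (sum-single (λ b → 𝟙 (φ b) x) a)
    where
    swap : ∀ p q → (if p then (if q then 1 else 0) else 0) ≡ (if q then (if p then 1 else 0) else 0)
    swap true  true  = refl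
    swap true  false = refl
    swap false true  = refl
    swap false false = refl

  flow-χ-∷ : ∀ φ {a P} → a ∉ P → ∀ x → flow φ (χ (a ∷ P)) x ≡ 𝟙 (φ a) x + flow φ (χ P) x
  flow-χ-∷ φ {a} {P} a∉P x = begin
    flow φ (χ (a ∷ P)) x                       ≡⟨ flow-cong φ x (χ-∷ a∉P) ⟩
    flow φ (λ b → 𝟙 b a + χ P b) x              ≡⟨ flow-+ φ (λ b → 𝟙 b a) (χ P) x ⟩
    flow φ (λ b → 𝟙 b a) x + flow φ (χ P) x     ≡⟨ cong (_+ _) (flow-𝟙 φ a x) ⟩
    𝟙 (φ a) x + flow φ (χ P) x                  ∎
    where open ≡-Reasoning

  -- The contributions of consecutive arcs telescope, leaving divergence +1 at the start and -1 at
  -- the end; the end terms are placed so as to stay in ℕ. Arcs must be distinct because `χ` counts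
  -- a repeated arc only once.
  walk-balance : ∀ {x P y} → IsWalk x P y → Unique P → ∀ z →
    outflow (χ P) z + 𝟙 y z ≡ inflow (χ P) z + 𝟙 x z
  walk-balance {x} [] _ z = cong (_+ 𝟙 x z) (trans (flow-0 tail z) (sym (flow-0 head z)))
  walk-balance {y = y} (_∷_ {a = a} {P} refl W) P! z with a∉P ← Unique[x∷xs]⇒x∉xs P! | _ ∷ P!′ ← P! = begin
    outflow (χ (a ∷ P)) z + 𝟙 y z                  ≡⟨ cong (_+ 𝟙 y z) (flow-χ-∷ tail a∉P z) ⟩
    𝟙 (tail a) z + outflow (χ P) z + 𝟙 y z          ≡⟨ +-assoc (𝟙 (tail a) z) _ _ ⟩
    𝟙 (tail a) z + (outflow (χ P) z + 𝟙 y z)        ≡⟨ cong (𝟙 (tail a) z +_) (walk-balance W P!′ z) ⟩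
    𝟙 (tail a) z + (inflow (χ P) z + 𝟙 (head a) z)  ≡⟨ +-comm (𝟙 (tail a) z) _ ⟩
    inflow (χ P) z + 𝟙 (head a) z + 𝟙 (tail a) z    ≡⟨ cong (_+ 𝟙 (tail a) z) (+-comm (inflow (χ P) z) _) ⟩
    𝟙 (head a) z + inflow (χ P) z + 𝟙 (tail a) z    ≡⟨ cong (_+ 𝟙 (tail a) z) (flow-χ-∷ head a∉P z) ⟨
    inflow (χ (a ∷ P)) z + 𝟙 (tail a) z             ∎
    where open ≡-Reasoning

  -- Composing with `σE` avoids the reversed list: by `χ-σP` the second summand is the incidence
  -- vector of `σP P`.
  χ² : List E → E → ℕ
  χ² P a = χ P a + χ P (σE a)

  χ²-symmetric : ∀ P → Symmetric (χ² P)
  χ²-symmetric P a =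
    trans (+-comm (χ P a) _) (cong (λ b → χ P (σE a) + χ P b) (sym (σE-involutive a)))

  χ²≤2 : ∀ P a → χ² P a ≤ 2
  χ²≤2 P a = +-mono-≤ (χ≤1 P a) (χ≤1 P (σE a))

  χ²-mono : ∀ {P Q} → P ⊆ Q → ∀ a → χ² P a ≤ χ² Q a
  χ²-mono P⊆Q a = +-mono-≤ (χ-mono P⊆Q a) (χ-mono P⊆Q (σE a))

  χ²-∷ : ∀ {a P} → a ∉ P → ∀ b → χ² (a ∷ P) b ≡ χ² P b + (𝟙 b a + 𝟙 (σE b) a)
  χ²-∷ {a} {P} a∉P b = begin
    χ² (a ∷ P) b                                        ≡⟨ cong₂ _+_ (χ-∷ a∉P b) (χ-∷ a∉P (σE b)) ⟩
    (𝟙 b a + χ P b) + (𝟙 (σE b) a + χ P (σE b))         ≡⟨ +-interchange (𝟙 b a) _ _ _ ⟩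
    (𝟙 b a + 𝟙 (σE b) a) + χ² P b                       ≡⟨ +-comm (𝟙 b a + 𝟙 (σE b) a) _ ⟩
    χ² P b + (𝟙 b a + 𝟙 (σE b) a)                       ∎
    where open ≡-Reasoning

  flow-χ² : ∀ {φ ψ} → (∀ a → φ (σE a) ≡ σV (ψ a)) → ∀ P x →
            flow φ (χ² P) x ≡ flow φ (χ P) x + flow ψ (χ P) (σV x)
  flow-χ² {φ} {ψ} φσ P x =
    trans (flow-+ φ (χ P) (χ P ∘ σE) x) (cong (flow φ (χ P) x +_) (flow-σ {φ} {ψ} φσ (χ P) x))

  -- Add the balance of `P` at `z` to its balance at `σV z` read from right to left: the mate of `P`
  -- runs from `σV y` to `σV x`, and its outflow at `z` is the inflow of `P` at `σV z`.
  χ²-balance : ∀ {x P y} → IsWalk x P y → Unique P → ∀ z →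
    outflow (χ² P) z + (𝟙 y z + 𝟙 x (σV z)) ≡ inflow (χ² P) z + (𝟙 x z + 𝟙 y (σV z))
  χ²-balance {x} {P} {y} W P! z = begin
    outflow (χ² P) z + (𝟙 y z + 𝟙 x (σV z))
      ≡⟨ cong (_+ (𝟙 y z + 𝟙 x (σV z))) (flow-χ² {tail} {head} tail-σE P z) ⟩
    (outflow (χ P) z + inflow (χ P) (σV z)) + (𝟙 y z + 𝟙 x (σV z))
      ≡⟨ +-interchange (outflow (χ P) z) _ _ _ ⟩
    (outflow (χ P) z + 𝟙 y z) + (inflow (χ P) (σV z) + 𝟙 x (σV z))
      ≡⟨ cong₂ _+_ (walk-balance W P! z) (sym (walk-balance W P! (σV z))) ⟩
    (inflow (χ P) z + 𝟙 x z) + (outflow (χ P) (σV z) + 𝟙 y (σV z))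
      ≡⟨ +-interchange (inflow (χ P) z) _ _ _ ⟩
    (inflow (χ P) z + outflow (χ P) (σV z)) + (𝟙 x z + 𝟙 y (σV z))
      ≡⟨ cong (_+ (𝟙 x z + 𝟙 y (σV z))) (flow-χ² {head} {tail} head-σE P z) ⟨
    inflow (χ² P) z + (𝟙 x z + 𝟙 y (σV z)) ∎
    where open ≡-Reasoning

  -- By symmetry the slack at `a` is also present at its mate, and as the two arcs differ, each has
  -- to absorb only one unit. This serves both to add an arc to an admissible path and to show that
  -- the potential drops by 2.
  raise-pair : ∀ {g h} → Symmetric g → Symmetric h → (∀ b → g b ≤ h b) →
    ∀ {a} → g a < h a → ∀ b → g b + (𝟙 b a + 𝟙 (σE b) a) ≤ h b
  raise-pair {g} {h} g-sym h-sym g≤h {a} ga<ha b with b ≟ a | σE b ≟ a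
  ... | yes refl | yes σa≡a = contradiction σa≡a (σE-fixfree b)
  ... | yes refl | no  _    = subst (_≤ h b) (+-comm 1 (g b)) ga<ha
  ... | no  _    | yes refl =
    subst (_≤ h b) (+-comm 1 (g b)) (subst₂ _<_ (sym (g-sym b)) (sym (h-sym b)) ga<ha)
  ... | no  _    | no  _    = subst (_≤ h b) (sym (+-identityʳ (g b))) (g≤h b)

  sum-pair : ∀ a → sum (λ b → 𝟙 b a + 𝟙 (σE b) a) ≡ 2
  sum-pair a = trans (∑-distrib-+ (λ b → 𝟙 b a) (λ b → 𝟙 (σE b) a)) (cong₂ _+_ (sum-single (λ _ → 1) a)
    (trans (sum-cong-≗ λ b → cong (if_then 1 else 0)
             (does-⇔ (mk⇔ (λ { refl → sym (σE-involutive b) }) (λ { refl → σE-involutive a }))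
                     (σE b ≟ a) (b ≟ σE a)))
           (sum-single (λ _ → 1) (σE a))))

  sum-raise-pair : ∀ g a → sum (λ b → g b + (𝟙 b a + 𝟙 (σE b) a)) ≡ sum g + 2
  sum-raise-pair g a = trans (∑-distrib-+ g (λ b → 𝟙 b a + 𝟙 (σE b) a)) (cong (sum g +_) (sum-pair a))

  -- Extending an admissible path backwards.

  entering-arc : ∀ {g f y} → inflow g y < inflow f y → ∃[ a ] (head a ≡ y × g a < f a)
  entering-arc {g} {f} {y} in< with any? {P = λ a → head a ≡ y × g a < f a} 
                                (λ a → (head a ≟ y) ×-dec (g a <? f a))
  ... | yes found = found
  ... | no  ¬∃    = contradiction in<
    (≤⇒≯ (flow-mono head λ a eq → ≮⇒≥ λ ga<fa → ¬∃ (a , eq , ga<fa)))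

  walk-end-∈ : ∀ {x P y} → IsWalk x P y → y ∈ x ∷ map head P
  walk-end-∈ []         = here refl
  walk-end-∈ (refl ∷ W) = there (walk-end-∈ W)

  -- Cut the walk after the arc that enters `z`. The start is not listed in `map head P`, so the
  -- prefix is nonempty even for `z = x`, when it is a simple cycle.
  walk-prefix : ∀ {x P y z} → IsWalk x P y → Unique (map head P) → z ∈ map head P →
    ∃[ Q ] (Q ≢ [] × IsWalk x Q z × Q ⊆ P × Unique (map head Q))
  walk-prefix (_∷_ {a = a} e W) _ (here refl) =
    a ∷ [] , (λ ()) , e ∷ [] , (λ { (here eq) → here eq }) , [] ∷ []
  walk-prefix (_∷_ {a = a} e W) (a∉ ∷ P!) (there z∈)
    with Q , _ , WQ , Q⊆P , Q! ← walk-prefix W P! z∈ =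
    a ∷ Q , (λ ()) , e ∷ WQ , Subset.∷⁺ʳ a Q⊆P , anti-mono (Subset.map⁺ head Q⊆P) a∉ ∷ Q!

  -- Paths end at the fixed vertex `t` and grow at their start until it satisfies `T`. The choices
  -- of `T` made later are one terminal, the other terminal, and the empty set, which leaves only
  -- cycles.
  module _ {f : E → ℕ} (f-sym : Symmetric f) {T : V → Set} (T? : Decidable T) {t : V}
           (deficit : ∀ y → y ≢ t → ¬ T y → outflow f y ≤ inflow f y) where

    CycleOrPath : Set
    CycleOrPath = ∃[ P ] ((∀ a → χ² P a ≤ f a) × P ≢ [] ×
                          (IsSimpleCycle P ⊎ ∃[ y ] (T y × IsSimplePath y P t)))

    -- `P` leaves its start `y` once more than it enters it. The mate ends at `σV y`, which is not
    -- `y`, so it cannot offset this surplus; it adds to it if it starts at `y`, which is the term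
    -- `𝟙 t (σV y)`.
    extendable : ∀ {y P} → IsSimplePath y P t → (∀ a → χ² P a ≤ f a) →
      y ≢ t → ¬ T y → inflow (χ² P) y < inflow f y
    extendable {y} {P} (W , _ ∷ P!) χ²≤f y≢t ¬Ty = begin-strict
      inflow (χ² P) y                          <⟨ m<m+n _ z<s ⟩
      inflow (χ² P) y + suc (𝟙 t (σV y))        ≡⟨ balance ⟨
      outflow (χ² P) y                         ≤⟨ flow-mono tail (λ a _ → χ²≤f a) ⟩
      outflow f y                              ≤⟨ deficit y y≢t ¬Ty ⟩
      inflow f y                               ∎
      where
      open ≤-Reasoning
      balance : outflow (χ² P) y ≡ inflow (χ² P) y + suc (𝟙 t (σV y))
      balance = trans (sym (+-identityʳ _))
        (trans (cong (outflow (χ² P) y +_)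
                 (sym (cong₂ _+_ (𝟙-≢ (y≢t ∘ sym)) (𝟙-≢ (σV-fixfree y ∘ sym)))))
        (trans (χ²-balance W (map⁻ P!) y)
               (cong (λ k → inflow (χ² P) y + (k + 𝟙 t (σV y))) (𝟙-refl y))))

    -- `n` is fuel. Each new arc raises `sum (χ² P)` by 2, while admissibility keeps it at most
    -- `sum f`, so the fuel may fall by one per step, and fuel zero contradicts the admissibility of
    -- `a ∷ P`.
    extend : ∀ n {y P} → sum f ≤ n + sum (χ² P) → IsSimplePath y P t → (∀ a → χ² P a ≤ f a) →
      inflow (χ² P) y < inflow f y → CycleOrPath
    extend n {P = P} sum≤ (W , P!) χ²≤f in< with entering-arc in<
    ... | a , refl , χ²a<fa = result (tail a ∈V? map head (a ∷ P))
      where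
      a∉P : a ∉ P
      a∉P a∈P = Unique[x∷xs]⇒x∉xs P! (∈-map⁺ head a∈P)

      raised≤f : ∀ b → χ² P b + (𝟙 b a + 𝟙 (σE b) a) ≤ f b
      raised≤f = raise-pair (χ²-symmetric P) f-sym χ²≤f χ²a<fa

      aP≤f : ∀ b → χ² (a ∷ P) b ≤ f b
      aP≤f b = subst (_≤ f b) (sym (χ²-∷ a∉P b)) (raised≤f b)

      sum-aP : sum (χ² (a ∷ P)) ≡ sum (χ² P) + 2
      sum-aP = trans (sum-cong-≗ (χ²-∷ a∉P)) (sum-raise-pair (χ² P) a)

      result : Dec (tail a ∈ map head (a ∷ P)) → CycleOrPath
      -- Simplicity of `P` from `head a` already says that the heads of `a ∷ P` are distinct, so the
      -- part of the walk up to its return to `tail a` is a simple cycle.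
      result (yes z∈) with Q , Q≢[] , WQ , Q⊆ , Q! ← walk-prefix (refl ∷ W) P! z∈ =
        Q , (λ b → ≤-trans (χ²-mono Q⊆ b) (aP≤f b)) , Q≢[] , inj₁ (Q≢[] , (tail a , WQ) , Q!)
      result (no z∉) with T? (tail a)
      ... | yes Tz = a ∷ P , aP≤f , (λ ()) , inj₂ (tail a , Tz , refl ∷ W , ¬Any⇒All¬ _ z∉ ∷ P!)
      ... | no ¬Tz = continue n sum≤
        where
        path : IsSimplePath (tail a) (a ∷ P) t
        path = refl ∷ W , ¬Any⇒All¬ _ z∉ ∷ P!

        z≢t : tail a ≢ t
        -- The end `t` has been visited, whereas `tail a` is new.
        z≢t z≡t = z∉ (subst (_∈ _) (sym z≡t) (walk-end-∈ W))

        continue : ∀ n → sum f ≤ n + sum (χ² P) → CycleOrPath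
        continue zero sum≤ = contradiction (≤-trans (subst (_≤ sum f) sum-aP (sum-mono aP≤f)) sum≤)
                                           (m+1+n≰m (sum (χ² P)))
        continue (suc n) sum≤ = extend n fuel path aP≤f (extendable path aP≤f z≢t ¬Tz)
          where
          open ≤-Reasoning
          fuel : sum f ≤ n + sum (χ² (a ∷ P))
          fuel = begin
            sum f                    ≤⟨ sum≤ ⟩
            suc n + sum (χ² P)       ≡⟨ +-suc n _ ⟨
            n + suc (sum (χ² P))     ≤⟨ +-monoʳ-≤ n (m<m+n _ z<s) ⟩
            n + (sum (χ² P) + 2)     ≡⟨ cong (n +_) sum-aP ⟨
            n + sum (χ² (a ∷ P))     ∎

    -- Start from the empty path at `t`. As `deficit` says nothing about `t`, the positive inflow
    -- there has to supply the first arc.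
    cycle-or-path : 0 < inflow f t → CycleOrPath
    cycle-or-path 0<in = extend (sum f) (m≤m+n _ _) ([] , [] ∷ []) (λ _ → z≤n)
      (subst (_< inflow f t) (sym (flow-0 head t)) 0<in)

-- Admissible cycles and terminal paths in a network.

module Network (N : SkewSymmetricNetwork) where
  open SkewSymmetricNetwork N
  open Graph graph

  Shape : List E → Set
  Shape P = IsSimpleCycle P ⊎ IsSimplePath s P s′ ⊎ IsSimplePath s′ P s

  balanced : ∀ {f} → IsISFlow f → ∀ x → x ≢ s → x ≢ s′ → outflow f x ≡ inflow f x
  balanced isf x x≢s x≢s′ = ⊖≡0⇒≡ _ _ (IsISFlow.conservation isf x x≢s x≢s′)

  -- The sign of the divergence at `s` decides where to start. If negative, build a path ending at
  -- `s`; if positive, one ending at `s′`, whose inflow equals the outflow at `s`; if zero, `f` is a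
  -- circulation, and the search starts at the head of an arc carrying flow.
  admissible : ∀ {f} → IsISFlow f → ∀ {a} → 0 < f a →
               ∃[ P ] ((∀ b → χ² P b ≤ f b) × P ≢ [] × Shape P)
  admissible {f} isf {a} 0<fa with <-cmp (outflow f s) (inflow f s)
  ... | tri< out<in _ _
    with cycle-or-path f-sym (_≟ s′)
           (λ y y≢s y≢s′ → ≤-reflexive (balanced isf y y≢s y≢s′)) (≤-<-trans z≤n out<in)
    where f-sym = IsISFlow.symmetric isf
  ...   | P , ≤f , P≢[] , inj₁ cycle           = P , ≤f , P≢[] , inj₁ cycle
  ...   | P , ≤f , P≢[] , inj₂ (_ , refl , path) = P , ≤f , P≢[] , inj₂ (inj₂ path)
  admissible {f} isf {a} 0<fa | tri> _ _ in<out
    with cycle-or-path f-sym (_≟ s)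
           (λ y y≢s′ y≢s → ≤-reflexive (balanced isf y y≢s y≢s′))
           (subst (0 <_) (sym (inflow-σ f-sym s)) (≤-<-trans z≤n in<out))
    where f-sym = IsISFlow.symmetric isf
  ...   | P , ≤f , P≢[] , inj₁ cycle           = P , ≤f , P≢[] , inj₁ cycle
  ...   | P , ≤f , P≢[] , inj₂ (_ , refl , path) = P , ≤f , P≢[] , inj₂ (inj₁ path)
  admissible {f} isf {a} 0<fa | tri≈ _ out≡in _
    with cycle-or-path f-sym {T = λ _ → ⊥} (λ _ → no λ ()) (λ y _ _ → ≤-reflexive (everywhere y)) 0<in
    where
    f-sym = IsISFlow.symmetric isf
    everywhere : ∀ y → outflow f y ≡ inflow f y
    everywhere y with y ≟ s | y ≟ s′
    ... | yes refl | _        = out≡in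
    ... | no _     | yes refl = trans (outflow-σ f-sym s) (trans (sym out≡in) (sym (inflow-σ f-sym s)))
    ... | no y≢s   | no y≢s′  = balanced isf y y≢s y≢s′
    0<in : 0 < inflow f (head a)
    0<in = begin-strict
      0                                   <⟨ z<s ⟩
      1                                   ≡⟨ 𝟙-refl (head a) ⟨
      𝟙 (head a) (head a)                 ≡⟨ flow-𝟙 head a (head a) ⟨
      inflow (λ b → 𝟙 b a) (head a)       ≤⟨ flow-mono head (λ b _ → 𝟙≤f b) ⟩
      inflow f (head a)                   ∎
      where
      open ≤-Reasoning
      𝟙≤f : ∀ b → 𝟙 b a ≤ f b
      𝟙≤f b with b ≟ a
      ... | yes refl = 0<fa
      ... | no _     = z≤n
  -- With `T` empty the path alternative cannot occur.
  ...   | P , ≤f , P≢[] , inj₁ cycle           = P , ≤f , P≢[] , inj₁ cycle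

  -- For a cycle the end terms on both sides of `χ²-balance` coincide and cancel; for a path all
  -- four vanish away from the terminals. Distinct heads give the distinct arcs that `χ²-balance`
  -- requires.
  shape-balance : ∀ {P} → Shape P → ∀ x → x ≢ s → x ≢ s′ → outflow (χ² P) x ≡ inflow (χ² P) x
  shape-balance (inj₁ (_ , (x , W) , P!)) z _ _ =
    +-cancelʳ-≡ _ _ _ (χ²-balance W (map⁻ P!) z)
  shape-balance {P} (inj₂ path) z z≢s z≢s′ = by-ends path
    where
    𝟙s≡0 : 𝟙 s z ≡ 0
    𝟙s≡0 = 𝟙-≢ (z≢s ∘ sym)
    𝟙s′≡0 : 𝟙 s′ z ≡ 0
    𝟙s′≡0 = 𝟙-≢ (z≢s′ ∘ sym)
    𝟙sσ≡0 : 𝟙 s (σV z) ≡ 0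
    𝟙sσ≡0 = 𝟙-≢ (z≢s′ ∘ σV-adjoint ∘ sym)
    𝟙s′σ≡0 : 𝟙 s′ (σV z) ≡ 0
    𝟙s′σ≡0 = 𝟙-≢ λ eq → z≢s (trans (σV-adjoint (sym eq)) (σV-involutive s))

    by-ends : IsSimplePath s P s′ ⊎ IsSimplePath s′ P s → outflow (χ² P) z ≡ inflow (χ² P) z
    by-ends (inj₁ (W , _ ∷ P!)) = +-cancelʳ-≡ 0 _ _
      (subst₂ (λ k l → outflow (χ² P) z + k ≡ inflow (χ² P) z + l)
              (cong₂ _+_ 𝟙s′≡0 𝟙sσ≡0) (cong₂ _+_ 𝟙s≡0 𝟙s′σ≡0) (χ²-balance W (map⁻ P!) z))
    by-ends (inj₂ (W , _ ∷ P!)) = +-cancelʳ-≡ 0 _ _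
      (subst₂ (λ k l → outflow (χ² P) z + k ≡ inflow (χ² P) z + l)
              (cong₂ _+_ 𝟙s≡0 𝟙s′σ≡0) (cong₂ _+_ 𝟙s′≡0 𝟙sσ≡0) (χ²-balance W (map⁻ P!) z))

  -- Multiples and differences of flows.

  multiple-isISFlow : ∀ {f P} → IsISFlow f → Shape P → ∀ {δ} → (∀ a → δ * χ² P a ≤ f a) →
                      IsISFlow (λ a → δ * χ² P a)
  multiple-isISFlow {P = P} isf shape {δ} ≤f = record
    { capacity     = λ a → ≤-trans (≤f a) (IsISFlow.capacity isf a)
    ; conservation = λ x x≢s x≢s′ → ≡⇒⊖≡0 (trans (flow-* tail δ (χ² P) x)
        (trans (cong (δ *_) (shape-balance shape x x≢s x≢s′)) (sym (flow-* head δ (χ² P) x))))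
    ; symmetric    = λ a → cong (δ *_) (χ²-symmetric P a)
    }

  -- Since `g ≤ f`, truncated subtraction is exact, so the flow of `f` through a vertex is the sum
  -- of those of `g` and the difference, and conservation follows by cancelling `g`.
  ∸-isISFlow : ∀ {f g} → IsISFlow f → IsISFlow g → (∀ a → g a ≤ f a) → IsISFlow (λ a → f a ∸ g a)
  ∸-isISFlow {f} {g} isf isg g≤f = record
    { capacity     = λ a → ≤-trans (m∸n≤m (f a) (g a)) (IsISFlow.capacity isf a)
    ; conservation = λ x x≢s x≢s′ → ≡⇒⊖≡0 (+-cancelˡ-≡ (inflow g x) _ _ (begin
        inflow g x + outflow (λ a → f a ∸ g a) x   ≡⟨ cong (_+ outflow (λ a → f a ∸ g a) x) (balanced isg x x≢s x≢s′) ⟨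
        outflow g x + outflow (λ a → f a ∸ g a) x  ≡⟨ split tail x ⟩
        outflow f x                                ≡⟨ balanced isf x x≢s x≢s′ ⟩
        inflow f x                                 ≡⟨ split head x ⟨
        inflow g x + inflow (λ a → f a ∸ g a) x    ∎))
    ; symmetric    = λ a → cong₂ _∸_ (IsISFlow.symmetric isf a) (IsISFlow.symmetric isg a)
    }
    where
    open ≡-Reasoning
    split : ∀ φ x → flow φ g x + flow φ (λ a → f a ∸ g a) x ≡ flow φ f x
    split φ x = trans (sym (flow-+ φ g (λ a → f a ∸ g a) x)) (flow-cong φ x λ a → m+[n∸m]≡n (g≤f a))

  -- The potential and the subtraction of one elementary flow.

  Φ : (E → ℕ) → ℕ
  Φ f = sum (λ a → f a ⊓ 2)

  -- `potential` limits the number of steps. `exhausted` gives distinctness: on `a`, too little is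
  -- left for `g` to be subtracted again.
  record Peeling (f : E → ℕ) : Set where
    field
      g          : E → ℕ
      elementary : IsElementaryFlow g
      g≤f        : ∀ a → g a ≤ f a
      a          : E
      exhausted  : f a ∸ g a < g a
      potential  : Φ (λ b → f b ∸ g b) + 2 ≤ Φ f

  peel : ∀ {f} → IsISFlow f → ∀ {a} → 0 < f a → Peeling f
  peel isf 0<fa with admissible isf 0<fa
  ... | [] , _ , P≢[] , _ = contradiction refl P≢[]
  peel {f} isf _ | P@(a₀ ∷ _) , χ²≤f , _ , shape
    -- The search starts at `δ = 1`, feasible by admissibility; `a₀` lies on `P`, so `χ² P a₀` is
    -- positive and `f a₀` is enough fuel.
    with maximal-multiple (χ² P) f a₀ (≤-trans (≤-reflexive (sym (χ-∈ {P} (here refl)))) (m≤m+n _ (χ P (σE a₀))))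
           (f a₀) 1 (m≤m+n _ 1) (λ b → subst (_≤ f b) (sym (*-identityˡ (χ² P b))) (χ²≤f b))
  ... | δ , 1≤δ , g≤f , a , f<[1+δ]χ² = record
    { g          = λ b → δ * χ² P b
    ; elementary = record
      { isISFlow = g-isISFlow
      ; P        = P
      ; shape    = shape
      ; δ        = δ
      ; δ>0      = 1≤δ
      ; formula  = λ b → trans (*-distribˡ-+ δ (χ P b) _)
                               (cong (λ k → δ * χ P b + δ * k) (sym (χ-σP P b)))
      }
    ; g≤f        = g≤f
    ; a          = a
    ; exhausted  = <-≤-trans rest<χ² χ²≤g
    ; potential  = ≤-trans (≤-reflexive (sym (sum-raise-pair (λ b → rest b ⊓ 2) a)))
        (sum-mono (raise-pair
          (λ b → cong (_⊓ 2) (IsISFlow.symmetric (∸-isISFlow isf g-isISFlow g≤f) b))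
          (λ b → cong (_⊓ 2) (IsISFlow.symmetric isf b))
          (λ b → ⊓-monoˡ-≤ 2 (m∸n≤m (f b) (δ * χ² P b)))
          -- `χ² P a` is at most both `f a` and 2, so a remainder below it makes the capped value at
          -- `a` drop strictly.
          (≤-<-trans (m⊓n≤m (rest a) 2)
            (⊓-pres-m< (<-≤-trans rest<χ² (χ²≤f a)) (<-≤-trans rest<χ² (χ²≤2 P a))))))
    }
    where
    g-isISFlow : IsISFlow (λ b → δ * χ² P b)
    g-isISFlow = multiple-isISFlow isf shape {δ} g≤f

    rest : E → ℕ
    rest b = f b ∸ δ * χ² P b

    χ²≤g : χ² P a ≤ δ * χ² P a
    χ²≤g = m≤n*m (χ² P a) δ {{>-nonZero 1≤δ}}

    rest<χ² : rest a < χ² P a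
    rest<χ² = +-cancelˡ-< (δ * χ² P a) _ _ (subst₂ _<_ (sym (m+[n∸m]≡n (g≤f a)))
                (+-comm (χ² P a) _) f<[1+δ]χ²)

  -- Assembling the decomposition.

  summands-bounded : ∀ (D : List (E → ℕ)) (a : E) → All (λ g → g a ≤ List.sum (map (λ g → g a) D)) D
  summands-bounded []      a = []
  summands-bounded (g ∷ D) a =
    m≤m+n (g a) _ ∷ All.map (λ h≤ → ≤-trans h≤ (m≤n+m _ (g a))) (summands-bounded D a)

  decompose : ∀ n {f} → IsISFlow f → Φ f ≤ n * 2 →
              ∃[ D ] (IsSymmetricDecomposition D f × length D ≤ n)
  decompose n {f} isf Φ≤ with any? (λ a → 0 <? f a)
  ... | no ¬∃ = [] , record
    { elementary = [] ; distinct = [] ; sums-to = λ a → n≤0⇒n≡0 (≮⇒≥ λ 0<fa → ¬∃ (a , 0<fa)) } , z≤n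
  -- `n` is split only once `f` is known to be nonzero: then the potential is at least 2, which
  -- excludes `n = 0`.
  ... | yes (_ , 0<f) = add n Φ≤
    where
    open Peeling (peel isf 0<f)

    add : ∀ n → Φ f ≤ n * 2 → ∃[ D ] (IsSymmetricDecomposition D f × length D ≤ n)
    add zero    Φ≤ = contradiction (≤-trans (m≤n+m 2 _) (≤-trans potential Φ≤)) λ ()
    add (suc n) Φ≤
      with D , dec , len ← decompose n (∸-isISFlow isf (IsElementaryFlow.isISFlow elementary) g≤f)
             (+-cancelʳ-≤ 2 _ _ (≤-trans potential (≤-trans Φ≤ (≤-reflexive (+-comm 2 (n * 2)))))) =
      g ∷ D , record
        { elementary = elementary ∷ IsSymmetricDecomposition.elementary dec
        ; distinct   = All.map (λ {h} → new h) (summands-bounded D a) ∷ IsSymmetricDecomposition.distinct dec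
        ; sums-to    = λ b → trans (sym (m+[n∸m]≡n (g≤f b)))
                                   (cong (g b +_) (IsSymmetricDecomposition.sums-to dec b))
        } , s≤s len
      where
      new : ∀ (h : E → ℕ) → h a ≤ List.sum (map (λ g → g a) D) → ¬ (∀ b → g b ≡ h b)
      -- Later flows sum to the remainder, so on the exhausted arc each of them is smaller than `g`.
      new h ha≤ g≗h = <⇒≱ exhausted
        (subst₂ _≤_ (sym (g≗h a)) (sym (IsSymmetricDecomposition.sums-to dec a)) ha≤)

mainTheorem2 : (N : SkewSymmetricNetwork) → let open SkewSymmetricNetwork N in
    (f : E → ℕ) → IsISFlow f →
    ∃[ D ] (IsSymmetricDecomposition D f × length D ≤ |E|)
mainTheorem2 N f isf = Network.decompose N _ isf (sum≤n*k 2 λ a → m⊓n≤n (f a) 2)
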